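{- Let $\mathcal V$ be a Stone variety of profinite $\Omega$-algebras. Then $\mathcal V\cap\mathsf{Fin}_\Omega$ is the least Stone pseudovariety $\mathcal S$ (with respect to inclusion) such that $\widehat{\mathcal S}=\mathcal V$.
   Context: $\Omega=\biguplus_n\Omega_n$ is a fixed topological signature; a Stone topological $\Omega$-algebra is a compact Hausdorff 0-dimensional space with continuous evaluation maps $\Omega_n\times A^n\to A$. A topological algebra is profinite if it is compact and any two distinct elements are separated by a continuous homomorphism into a finite discrete algebra. $\mathsf{Fin}_\Omega$ is the class of all finite (discrete) topological $\Omega$-algebras. A Stone pseudovariety is a nonempty class of Stone topological algebras closed under images by onto continuous homomorphisms that are Stone topological algebras, closed subalgebras, and finite direct products; a Stone variety is defined likewise with arbitrary direct products. For a class $\mathcal S$, $\widehat{\mathcal S}$ is the class of Stone topological algebras that are residually $\mathcal S$ (any two distinct elements separated by a continuous homomorphism into a member of $\mathcal S$). In the paper this least element is denoted $\mathcal V_{\min}$. -}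

module Defs where

open import Level using (Level; suc; _⊔_)
open import Data.Nat.Base using (ℕ)
open import Data.Fin.Base using (Fin)
open import Data.List.Base using (List; []; _∷_; _++_)
open import Data.List.Relation.Unary.Any using (Any)
open import Data.Product.Base using (Σ; Σ-syntax; ∃; ∃-syntax; _×_; _,_; proj₁; proj₂)
open import Data.Product.Relation.Binary.Pointwise.NonDependent using (×-setoid)
open import Data.Unit.Polymorphic.Base using (⊤; tt)
open import Function.Base using (_∘_; id)
open import Function.Bundles using (Func; Inverse)
open import Function.Definitions using (Surjective)
open import Relation.Binary.Bundles using (Setoid)
open import Relation.Binary.Definitions using (_Respects_)
open import Relation.Binary.PropositionalEquality.Properties using (setoid)
open import Relation.Nullary.Negation.Core using (¬_)
open import Relation.Unary using (Pred; _∈_; _⊆_; _≐_; _∩_; _⊢_; ∁; ⋃)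
import Relation.Binary.Construct.On as On

-- A set is a setoid in the universe ℓ, a subset a predicate at the same
-- level that respects the setoid equality.  Classically every family of
-- subsets of a small set can be indexed by a type in the same universe, so
-- unions and covers over I : Set ℓ are the general ones.

record Space ℓ : Set (suc (suc ℓ)) where
  field
    points : Setoid ℓ ℓ

  open Setoid points public using (Carrier; _≈_)

  field
    Open        : Pred (Pred Carrier ℓ) (suc ℓ)
    open-resp-≈ : ∀ {U} → Open U → U Respects _≈_
    open-resp-≐ : ∀ {U V} → U ≐ V → Open U → Open V
    open-⊤      : Open (λ _ → ⊤)
    open-∩      : ∀ {U V} → Open U → Open V → Open (U ∩ V)
    open-⋃      : ∀ {I : Set ℓ} (U : I → Pred Carrier ℓ) →
                  (∀ i → Open (U i)) → Open (⋃ I U)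

  Closed : Pred (Pred Carrier ℓ) (suc ℓ)
  Closed C = C Respects _≈_ × Open (∁ C)

open Space using (Carrier; Open; Closed)

module _ {ℓ} (X : Space ℓ) where
  open Space X using (_≈_)

  Compact : Set (suc ℓ)
  Compact = ∀ {I : Set ℓ} (U : I → Pred (Carrier X) ℓ) →
            (∀ i → Open X (U i)) → (∀ x → x ∈ ⋃ I U) →
            Σ[ is ∈ List I ] (∀ x → Any (λ i → x ∈ U i) is)

  Hausdorff : Set (suc ℓ)
  Hausdorff = ∀ x y → ¬ (x ≈ y) →
              ∃[ U ] ∃[ V ] Open X U × Open X V × x ∈ U × y ∈ V ×
                            (∀ {z} → z ∈ U → ¬ (z ∈ V))

  ZeroDimensional : Set (suc ℓ)
  ZeroDimensional = ∀ {U} → Open X U → ∀ {x} → x ∈ U →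
                    ∃[ W ] Open X W × Closed X W × x ∈ W × W ⊆ U

  Discrete : Set (suc ℓ)
  Discrete = ∀ (U : Pred (Carrier X) ℓ) → U Respects _≈_ → Open X U

  Finite : Set ℓ
  Finite = ∃[ n ] Inverse (Space.points X) (setoid (Fin n))

Continuous : ∀ {ℓ} (X Y : Space ℓ) → (Carrier X → Carrier Y) → Set (suc ℓ)
Continuous X Y f = ∀ {U} → Open Y U → Open X (f ⊢ U)

record ContinuousMap {ℓ} (X Y : Space ℓ) : Set (suc ℓ) where
  field
    func       : Func (Space.points X) (Space.points Y)
    continuous : Continuous X Y (Func.to func)

  open Func func public using (to; cong)

open ContinuousMap using (to; cong; continuous)

locally-open : ∀ {ℓ} (X : Space ℓ) {U : Pred (Carrier X) ℓ} →
               (∀ {x} → x ∈ U → ∃[ V ] Open X V × x ∈ V × V ⊆ U) → Open X U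
locally-open X {U} nbhd = Space.open-resp-≐ X
  ( (λ { ((_ , x∈U) , z∈V) → proj₂ (proj₂ (proj₂ (nbhd x∈U))) z∈V })
  , (λ {x} x∈U → (x , x∈U) , proj₁ (proj₂ (proj₂ (nbhd x∈U)))) )
  (Space.open-⋃ X {I = ∃ U} (λ (_ , x∈U) → proj₁ (nbhd x∈U))
                            (λ (_ , x∈U) → proj₁ (proj₂ (nbhd x∈U))))

module _ {ℓ} (X Y : Space ℓ) where
  private
    module X = Space X
    module Y = Space Y

  infixr 2 _⊗_

  _⊗_ : Space ℓ
  _⊗_ = record
    { points      = P
    ; Open        = λ W → W Respects Setoid._≈_ P ×
                          (∀ {x y} → (x , y) ∈ W →
                           ∃[ U ] ∃[ V ] X.Open U × Y.Open V × x ∈ U × y ∈ V ×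
                                         (∀ {x′ y′} → x′ ∈ U → y′ ∈ V → (x′ , y′) ∈ W))
    ; open-resp-≈ = proj₁
    ; open-resp-≐ = λ { (U⊆V , V⊆U) (r , b) →
        (λ e v → U⊆V (r e (V⊆U v))) ,
        (λ v → let (A , B , oA , oB , a , b′ , s) = b (V⊆U v)
               in A , B , oA , oB , a , b′ , λ p q → U⊆V (s p q)) }
    ; open-⊤      = (λ _ _ → tt) ,
        (λ _ → (λ _ → ⊤) , (λ _ → ⊤) , X.open-⊤ , Y.open-⊤ , tt , tt , λ _ _ → tt)
    ; open-∩      = λ { (r , b) (r′ , b′) →
        (λ e (u , v) → r e u , r′ e v) ,
        (λ (u , v) →
          let (A , B , oA , oB , x , y , s) = b u
              (A′ , B′ , oA′ , oB′ , x′ , y′ , s′) = b′ v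
          in A ∩ A′ , B ∩ B′ , X.open-∩ oA oA′ , Y.open-∩ oB oB′ ,
             (x , x′) , (y , y′) ,
             λ (p , p′) (q , q′) → s p q , s′ p′ q′) }
    ; open-⋃      = λ _ o →
        (λ e (i , u) → i , proj₁ (o i) e u) ,
        (λ (i , u) → let (A , B , oA , oB , x , y , s) = proj₂ (o i) u
                     in A , B , oA , oB , x , y , λ p q → i , s p q)
    }
    where P = ×-setoid X.points Y.points

-- The levels are arranged so that both index types Fin n (i = 0) and
-- arbitrary index types in the universe of the factors (i = j) are covered.

module _ {i} (j : Level) {I : Set i} (X : I → Space (i ⊔ j)) where
  private
    module X k = Space (X k)

  Π-setoid : Setoid (i ⊔ j) (i ⊔ j)
  Π-setoid = record
    { Carrier       = ∀ k → Carrier (X k)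
    ; _≈_           = λ x y → ∀ k → X._≈_ k (x k) (y k)
    ; isEquivalence = record
      { refl  = λ k → Setoid.refl (X.points k)
      ; sym   = λ e k → Setoid.sym (X.points k) (e k)
      ; trans = λ e e′ k → Setoid.trans (X.points k) (e k) (e′ k)
      }
    }

  SubbasicOpen : Set (suc (i ⊔ j))
  SubbasicOpen = Σ[ k ∈ I ] Σ[ U ∈ Pred (Carrier (X k)) (i ⊔ j) ] Open (X k) U

  Cylinder : List SubbasicOpen → Pred (∀ k → Carrier (X k)) (i ⊔ j)
  Cylinder []                 x = ⊤
  Cylinder ((k , U , _) ∷ bs) x = x k ∈ U × x ∈ Cylinder bs

  Cylinder-++ : ∀ bs {cs x} → x ∈ Cylinder bs → x ∈ Cylinder cs →
                x ∈ Cylinder (bs ++ cs)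
  Cylinder-++ []       _       q = q
  Cylinder-++ (_ ∷ bs) (u , p) q = u , Cylinder-++ bs p q

  Cylinder-++⁻ : ∀ bs {cs x} → x ∈ Cylinder (bs ++ cs) →
                 x ∈ Cylinder bs × x ∈ Cylinder cs
  Cylinder-++⁻ []       q       = tt , q
  Cylinder-++⁻ (_ ∷ bs) (u , p) =
    let (l , r) = Cylinder-++⁻ bs p in (u , l) , r

  Π-space : Space (i ⊔ j)
  Π-space = record
    { points      = Π-setoid
    ; Open        = λ U → U Respects Setoid._≈_ Π-setoid ×
                          (∀ {x} → x ∈ U →
                           Σ[ bs ∈ List SubbasicOpen ] x ∈ Cylinder bs × Cylinder bs ⊆ U)
    ; open-resp-≈ = proj₁
    ; open-resp-≐ = λ { (U⊆V , V⊆U) (r , b) →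
        (λ e v → U⊆V (r e (V⊆U v))) ,
        (λ v → let (bs , p , s) = b (V⊆U v) in bs , p , λ q → U⊆V (s q)) }
    ; open-⊤      = (λ _ _ → tt) , (λ _ → [] , tt , λ _ → tt)
    ; open-∩      = λ { (r , b) (r′ , b′) →
        (λ e (u , v) → r e u , r′ e v) ,
        (λ (u , v) →
          let (bs , p , s) = b u
              (cs , q , t) = b′ v
          in bs ++ cs , Cylinder-++ bs p q ,
             λ w → s (proj₁ (Cylinder-++⁻ bs w)) , t (proj₂ (Cylinder-++⁻ bs w))) }
    ; open-⋃      = λ _ o →
        (λ e (k , u) → k , proj₁ (o k) e u) ,
        (λ (k , u) → let (bs , p , s) = proj₂ (o k) u in bs , p , λ q → k , s q)
    }

  Π-proj-continuous : ∀ k → Continuous Π-space (X k) (λ x → x k)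
  Π-proj-continuous k {U} oU =
    (λ e → X.open-resp-≈ k oU (e k)) ,
    (λ u → ((k , U , oU) ∷ []) , (u , tt) , proj₁)

  Π-tuple-continuous : ∀ (Z : Space (i ⊔ j)) (f : Carrier Z → Carrier Π-space) →
                       (∀ k → Continuous Z (X k) (λ z → f z k)) →
                       Continuous Z Π-space f
  Π-tuple-continuous Z f c {U} (_ , b) = locally-open Z λ u →
    let (bs , p , s) = b u in (f ⊢ Cylinder bs) , open-cyl bs , p , s
    where
    open-cyl : ∀ bs → Open Z (f ⊢ Cylinder bs)
    open-cyl []                  = Space.open-⊤ Z
    open-cyl ((k , _ , oV) ∷ bs) = Space.open-∩ Z (c k oV) (open-cyl bs)

infixl 8 _^ˢ_

_^ˢ_ : ∀ {ℓ} → Space ℓ → ℕ → Space ℓ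
_^ˢ_ {ℓ} X n = Π-space ℓ {I = Fin n} (λ _ → X)

powerMap-continuous : ∀ {ℓ} (Z X Y : Space ℓ) n (f : ContinuousMap X Y) →
                      Continuous (Z ⊗ X ^ˢ n) (Z ⊗ Y ^ˢ n) (λ (z , x) → z , to f ∘ x)
powerMap-continuous {ℓ} Z X Y n f (r , b) =
  (λ (e , e′) → r (e , λ k → cong f (e′ k))) ,
  (λ w → let (A , B , oA , oB , a , b′ , s) = b w
         in A , ((to f ∘_) ⊢ B) , oA , fⁿ-continuous oB , a , b′ , s)
  where
  fⁿ-continuous : Continuous (X ^ˢ n) (Y ^ˢ n) (to f ∘_)
  fⁿ-continuous = Π-tuple-continuous ℓ (λ _ → Y) (X ^ˢ n) (to f ∘_)
    (λ k oU → Π-proj-continuous ℓ (λ _ → X) k (continuous f oU))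

module _ {ℓ} (X : Space ℓ) (P : Pred (Carrier X) ℓ) where
  private
    module X = Space X

  subspace : Space ℓ
  subspace = record
    { points      = On.setoid {B = ∃ P} X.points proj₁
    ; Open        = λ U → ∃[ V ] X.Open V × U ≐ (proj₁ ⊢ V)
    ; open-resp-≈ = λ (_ , oV , U⊆V , V⊆U) e u → V⊆U (X.open-resp-≈ oV e (U⊆V u))
    ; open-resp-≐ = λ (U⊆W , W⊆U) (V , oV , U⊆V , V⊆U) →
        V , oV , (λ w → U⊆V (W⊆U w)) , (λ v → U⊆W (V⊆U v))
    ; open-⊤      = (λ _ → ⊤) , X.open-⊤ , id , id
    ; open-∩      = λ (V , oV , U⊆V , V⊆U) (V′ , oV′ , U′⊆V′ , V′⊆U′) →
        V ∩ V′ , X.open-∩ oV oV′ ,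
        (λ (u , u′) → U⊆V u , U′⊆V′ u′) , (λ (v , v′) → V⊆U v , V′⊆U′ v′)
    ; open-⋃      = λ {I} _ o →
        ⋃ I (λ i → proj₁ (o i)) , X.open-⋃ _ (λ i → proj₁ (proj₂ (o i))) ,
        (λ (i , u) → i , proj₁ (proj₂ (proj₂ (o i))) u) ,
        (λ (i , v) → i , proj₂ (proj₂ (proj₂ (o i))) v)
    }

  inclusion : ContinuousMap subspace X
  inclusion = record
    { func       = record { to = proj₁ ; cong = id }
    ; continuous = λ {V} oV → V , oV , id , id
    }

-- Ω n is the space of n-ary operation symbols; nothing is assumed of it.

Signature : ∀ ℓ → Set (suc (suc ℓ))
Signature ℓ = ℕ → Space ℓ

record TopAlgebra {ℓ} (Ω : Signature ℓ) : Set (suc (suc ℓ)) where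
  field
    space : Space ℓ
    eval  : ∀ n → ContinuousMap (Ω n ⊗ space ^ˢ n) space

  open Space space public using (Carrier; _≈_)

  op : ∀ {n} → Space.Carrier (Ω n) → (Fin n → Space.Carrier space) → Space.Carrier space
  op {n} ω x = to (eval n) (ω , x)

record ContinuousHom {ℓ} {Ω : Signature ℓ} (A B : TopAlgebra Ω) : Set (suc ℓ) where
  private
    module A = TopAlgebra A
    module B = TopAlgebra B
  field
    map : ContinuousMap A.space B.space
    hom : ∀ {n} (ω : Space.Carrier (Ω n)) (x : Fin n → A.Carrier) →
          to map (A.op ω x) B.≈ B.op ω (to map ∘ x)

  apply : A.Carrier → B.Carrier
  apply = to map

Onto : ∀ {ℓ} {Ω : Signature ℓ} {A B : TopAlgebra Ω} → ContinuousHom A B → Set ℓ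
Onto {A = A} {B} φ =
  Surjective (TopAlgebra._≈_ A) (TopAlgebra._≈_ B) (ContinuousHom.apply φ)

module _ {i} (j : Level) {Ω : Signature (i ⊔ j)} {I : Set i} (A : I → TopAlgebra Ω) where
  private
    module A k = TopAlgebra (A k)

  directProduct : TopAlgebra Ω
  directProduct = record
    { space = P
    ; eval  = λ n → record
      { func = record
        { to   = λ (ω , x) k → A.op k ω (λ m → x m k)
        ; cong = λ (e , e′) k → cong (A.eval k n) (e , λ m → e′ m k)
        }
      ; continuous = Π-tuple-continuous j A.space (Ω n ⊗ P ^ˢ n) _ λ k oU →
          powerMap-continuous (Ω n) P (A.space k) n (proj k) (continuous (A.eval k n) oU)
      }
    }
    where
    P : Space (i ⊔ j)
    P = Π-space j A.space
    proj : ∀ k → ContinuousMap P (A.space k)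
    proj k = record
      { func       = record { to = λ x → x k ; cong = λ e → e k }
      ; continuous = Π-proj-continuous j A.space k
      }

module _ {ℓ} {Ω : Signature ℓ} (A : TopAlgebra Ω) where
  private
    module A = TopAlgebra A

  record IsClosedSubalgebra (P : Pred A.Carrier ℓ) : Set (suc ℓ) where
    field
      closed    : Closed A.space P
      op-closed : ∀ {n} (ω : Space.Carrier (Ω n)) (x : Fin n → A.Carrier) →
                  (∀ m → x m ∈ P) → A.op ω x ∈ P

  subalgebra : (P : Pred A.Carrier ℓ) → IsClosedSubalgebra P → TopAlgebra Ω
  subalgebra P sub = record
    { space = subspace A.space P
    ; eval  = λ n → record
      { func = record
        { to   = λ (ω , x) → A.op ω (proj₁ ∘ x) ,
                             op-closed ω (proj₁ ∘ x) (λ m → proj₂ (x m))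
        ; cong = cong (A.eval n)
        }
      ; continuous = λ (V , oV , U⊆V , V⊆U) →
          Space.open-resp-≐ (Ω n ⊗ subspace A.space P ^ˢ n) (V⊆U , U⊆V)
            (powerMap-continuous (Ω n) (subspace A.space P) A.space n
              (inclusion A.space P) (continuous (A.eval n) oV))
      }
    }
    where open IsClosedSubalgebra sub

module _ {ℓ} {Ω : Signature ℓ} where
  open TopAlgebra using (space)

  IsStone : Pred (TopAlgebra Ω) (suc ℓ)
  IsStone A = Compact (space A) × Hausdorff (space A) × ZeroDimensional (space A)

  IsFinite : Pred (TopAlgebra Ω) (suc ℓ)
  IsFinite A = Finite (space A) × Discrete (space A)

  Residually : ∀ {s} → Pred (TopAlgebra Ω) s → Pred (TopAlgebra Ω) (suc (suc ℓ) ⊔ s)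
  Residually S A = ∀ x y → ¬ (x A.≈ y) →
    Σ[ B ∈ TopAlgebra Ω ] B ∈ S × Σ[ φ ∈ ContinuousHom A B ]
      ¬ (TopAlgebra._≈_ B (ContinuousHom.apply φ x) (ContinuousHom.apply φ y))
    where module A = TopAlgebra A

  IsProfinite : Pred (TopAlgebra Ω) (suc (suc ℓ))
  IsProfinite A = Compact (space A) × Residually IsFinite A

  Hat : ∀ {s} → Pred (TopAlgebra Ω) s → Pred (TopAlgebra Ω) (suc (suc ℓ) ⊔ s)
  Hat S = IsStone ∩ Residually S

  ClosedUnderStoneImages : ∀ {s} → Pred (TopAlgebra Ω) s → Set (suc (suc ℓ) ⊔ s)
  ClosedUnderStoneImages S = ∀ {A B} → A ∈ S → IsStone B →
                             (φ : ContinuousHom A B) → Onto φ → B ∈ S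

  ClosedUnderClosedSubalgebras : ∀ {s} → Pred (TopAlgebra Ω) s → Set (suc (suc ℓ) ⊔ s)
  ClosedUnderClosedSubalgebras S = ∀ {A} → A ∈ S → ∀ P (sub : IsClosedSubalgebra A P) →
                                   subalgebra A P sub ∈ S

  record IsStonePseudovariety {s} (S : Pred (TopAlgebra Ω) s) : Set (suc (suc ℓ) ⊔ s) where
    field
      stone          : S ⊆ IsStone
      nonempty       : ∃ S
      images         : ClosedUnderStoneImages S
      subalgebras    : ClosedUnderClosedSubalgebras S
      finiteProducts : ∀ n (A : Fin n → TopAlgebra Ω) → (∀ k → A k ∈ S) →
                       directProduct ℓ A ∈ S

  record IsStoneVariety {s} (S : Pred (TopAlgebra Ω) s) : Set (suc (suc ℓ) ⊔ s) where
    field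
      stone       : S ⊆ IsStone
      nonempty    : ∃ S
      images      : ClosedUnderStoneImages S
      subalgebras : ClosedUnderClosedSubalgebras S
      products    : ∀ (I : Set ℓ) (A : I → TopAlgebra Ω) → (∀ k → A k ∈ S) →
                    directProduct ℓ A ∈ S

{-# OPTIONS --safe #-}

-- If a Stone algebra A is separated by homomorphisms into members of a class,
-- it embeds into their product; a continuous image of a compact space in a
-- Hausdorff one is closed, so A is isomorphic to a closed subalgebra of that
-- product.  For a Stone variety this gives Hat (V ∩ IsFinite) ⊆ V.  If A is
-- finite, finitely many pairs of points have to be separated, so a finite
-- product suffices and A already belongs to every pseudovariety S with
-- A ∈ Hat S.  Conversely a homomorphism from A ∈ V to a finite algebra
-- corestricts to its image, which is a finite member of V.

module Submission where

open import Defs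
open import Axiom.ExcludedMiddle using (ExcludedMiddle)
open import Data.Empty using (⊥-elim)
open import Data.Fin.Base using (Fin; zero; suc; combine; remQuot)
open import Data.Fin.Properties using (remQuot-combine)
open import Data.List.Base using (List; []; _∷_; map; lookup; length; allFin; deduplicate; cartesianProductWith)
open import Data.List.Membership.Propositional.Properties using (∈-lookup)
open import Data.List.Relation.Unary.All as All using (_∷_)
open import Data.List.Relation.Unary.AllPairs using (_∷_)
open import Data.List.Relation.Unary.Any as Any using (Any; here; there)
open import Data.List.Relation.Unary.Any.Properties using (lookup-index; map⁺; tabulate⁺; cartesianProductWith⁺)
open import Data.List.Relation.Unary.Enumerates.Setoid using (IsEnumeration)
open import Data.List.Relation.Unary.Enumerates.Setoid.Properties using (deduplicate⁺)
open import Data.List.Relation.Unary.Unique.DecSetoid.Properties using (deduplicate-!)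
open import Data.List.Relation.Unary.Unique.Setoid using (Unique)
open import Data.Maybe.Base using (Maybe; just; nothing)
open import Data.Nat.Base using (zero; suc; _*_)
open import Data.Product.Base using (Σ-syntax; ∃; ∃-syntax; _×_; _,_; proj₁; proj₂; uncurry)
open import Data.Unit.Polymorphic.Base using (⊤; tt)
open import Function.Base using (_∘_; id)
open import Function.Bundles using (Inverse)
open import Function.Definitions using (Surjective)
open import Level using (Level; Lift; lift; lower; _⊔_)
open import Relation.Binary.Bundles using (Setoid; DecSetoid)
open import Relation.Binary.Definitions using (_Respects_; Decidable)
open import Relation.Binary.PropositionalEquality.Core as ≡ using (_≡_)
open import Relation.Binary.PropositionalEquality.Properties using (setoid)
open import Relation.Nullary.Decidable.Core using (yes; no; decidable-stable)
open import Relation.Nullary.Negation.Core using (¬_; contradiction)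
open import Relation.Unary using (Pred; _∈_; _∉_; _⊆_; _≐_; _∩_; _⊢_; ∁)

open Space using (Carrier; Open; Closed; points)
open ContinuousMap using (to; continuous)
open ContinuousHom using (apply)
open TopAlgebra using (space)

-- Finite setoids

-- The list may repeat points, so images and finite products need no decision of equality;
-- repetitions are removed only in `enumerable⇒finite`.
Enumerable : ∀ {a ℓ} → Setoid a ℓ → Set (a ⊔ ℓ)
Enumerable S = ∃ (IsEnumeration S)

module _ {a ℓ} (S : Setoid a ℓ) where
  open Setoid S using (_≈_; sym; trans; isEquivalence)

  lookup-injective : ∀ {xs} → Unique S xs → ∀ i j → lookup xs i ≈ lookup xs j → i ≡ j
  lookup-injective (_ ∷ _)    zero    zero    _ = ≡.refl
  lookup-injective (x≉xs ∷ _) zero    (suc j) e = contradiction e (All.lookup x≉xs (∈-lookup j))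
  lookup-injective (x≉xs ∷ _) (suc i) zero    e = contradiction (sym e) (All.lookup x≉xs (∈-lookup i))
  lookup-injective (_ ∷ xs!)  (suc i) (suc j) e = ≡.cong suc (lookup-injective xs! i j e)

  -- On a list without repetitions `lookup` is injective, so each point has a single position, and
  -- taking positions inverts `lookup`.
  enumerable⇒finite : Decidable _≈_ → Enumerable S → ∃[ n ] Inverse S (setoid (Fin n))
  enumerable⇒finite _≟_ (xs , ∈xs) = length ys , record
    { to        = index
    ; from      = lookup ys
    ; to-cong   = λ {x} {y} e → index≡ (trans (lookup≈ y) (sym e))
    ; from-cong = λ { ≡.refl → Setoid.refl S }
    ; inverse   = (λ e → index≡ (sym e)) ,
                  (λ { {x} ≡.refl → lookup≈ x })
    }
    where
    D : DecSetoid a ℓ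
    D = record { isDecEquivalence = record { isEquivalence = isEquivalence ; _≟_ = _≟_ } }
    ys = deduplicate _≟_ xs
    ∈ys : IsEnumeration S ys
    ∈ys = deduplicate⁺ D ∈xs
    index : Setoid.Carrier S → Fin (length ys)
    index x = Any.index (∈ys x)
    lookup≈ : ∀ x → lookup ys (index x) ≈ x
    lookup≈ x = sym (lookup-index (∈ys x))
    index≡ : ∀ {x i} → lookup ys i ≈ x → index x ≡ i
    index≡ {x} {i} e = lookup-injective (deduplicate-! D xs) (index x) i (trans (lookup≈ x) (sym e))

  finite⇒enumerable : ∃[ n ] Inverse S (setoid (Fin n)) → Enumerable S
  finite⇒enumerable (n , inv) = map from (allFin n) ,
    λ x → map⁺ (tabulate⁺ (Inverse.to inv x) (sym (Inverse.strictlyInverseʳ inv x)))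
    where open Inverse inv using (from)

module _ {a b ℓ ℓ′} (S : Setoid a ℓ) (T : Setoid b ℓ′) where
  private
    module S = Setoid S
    module T = Setoid T

  enumerable-image : (f : S.Carrier → T.Carrier) → Surjective S._≈_ T._≈_ f →
                     Enumerable S → Enumerable T
  enumerable-image f surj (xs , ∈xs) = map f xs , λ y →
    map⁺ (Any.map (λ e → T.sym (proj₂ (surj y) (S.sym e))) (∈xs (proj₁ (surj y))))

Π-enumerable : ∀ {ℓ} n (X : Fin n → Space ℓ) → (∀ k → Enumerable (points (X k))) →
               Enumerable (Π-setoid ℓ X)
Π-enumerable zero    X _    = (λ ()) ∷ [] , λ _ → here λ ()
Π-enumerable (suc n) X enum =
  cartesianProductWith cons (proj₁ (enum zero)) (proj₁ tails) ,
  λ x → cartesianProductWith⁺ cons (λ e e′ → λ { zero → e ; (suc k) → e′ k })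
          (proj₂ (enum zero) (x zero)) (proj₂ tails (x ∘ suc))
  where
  tails = Π-enumerable n (X ∘ suc) (enum ∘ suc)
  cons : Carrier (X zero) → (∀ k → Carrier (X (suc k))) → ∀ k → Carrier (X k)
  cons x f zero    = x
  cons x f (suc k) = f k

-- Compact, Hausdorff and discrete spaces

module _ {ℓ} (X : Space ℓ) (Xdisc : Discrete X) where
  open Space X using (_≈_; open-resp-≈)
  open Setoid (points X) using (refl; sym; trans)

  singleton-open : ∀ x → Open X (_≈ x)
  singleton-open x = Xdisc (_≈ x) (λ e → trans (sym e))

  finite-discrete⇒compact : Finite X → Compact X
  finite-discrete⇒compact fin U oU cover = map (proj₁ ∘ cover) xs ,
    λ x → map⁺ (Any.map (λ {y} e → open-resp-≈ (oU _) (sym e) (proj₂ (cover y))) (∈xs x))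
    where
    xs = proj₁ (finite⇒enumerable (points X) fin)
    ∈xs = proj₂ (finite⇒enumerable (points X) fin)

  discrete⇒hausdorff : Hausdorff X
  discrete⇒hausdorff x y x≉y = (_≈ x) , (_≈ y) , singleton-open x , singleton-open y ,
    refl , refl , λ z≈x z≈y → x≉y (trans (sym z≈x) z≈y)

  discrete⇒zero-dimensional : ZeroDimensional X
  discrete⇒zero-dimensional {U} oU x∈U =
    U , oU , (resp , Xdisc (∁ U) (λ e ∉U → ∉U ∘ resp (sym e))) , x∈U , id
    where
    resp : U Respects _≈_
    resp = open-resp-≈ oU

-- With finitely many coordinates, one cylinder can confine each of them to the class of `x k`. All
-- its points equal `x`, so it lies in `U`.
Π-discrete : ∀ {ℓ} n (X : Fin n → Space ℓ) → (∀ k → Discrete (X k)) →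
             Discrete (Π-space ℓ X)
Π-discrete {ℓ} n X disc U resp = resp , λ {x} x∈U →
  box x (allFin n) , ∈box x (allFin n) ,
  λ y∈box → resp (λ k → Setoid.sym (points (X k)) (box-≈ x (allFin n) y∈box (tabulate⁺ k ≡.refl))) x∈U
  where
  box : (∀ k → Carrier (X k)) → List (Fin n) → List (SubbasicOpen ℓ X)
  box x = map (λ k → k , _ , singleton-open (X k) (disc k) (x k))
  ∈box : ∀ x ks → x ∈ Cylinder ℓ X (box x ks)
  ∈box x []       = tt
  ∈box x (k ∷ ks) = Setoid.refl (points (X k)) , ∈box x ks
  box-≈ : ∀ x ks {y k} → y ∈ Cylinder ℓ X (box x ks) → Any (k ≡_) ks → Space._≈_ (X k) (y k) (x k)
  box-≈ x (_ ∷ _)  (e , _) (here ≡.refl) = e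
  box-≈ x (_ ∷ ks) (_ , c) (there k∈ks)  = box-≈ x ks c k∈ks

subspace-discrete : ∀ {ℓ} (X : Space ℓ) P → Discrete X → Discrete (subspace X P)
subspace-discrete X P disc U resp =
  V , disc V (λ e (z , u , z≈x) → z , u , Setoid.trans (points X) z≈x e) ,
  (λ {x} u → x , u , Setoid.refl (points X)) , (λ (z , u , z≈x) → resp z≈x u)
  where
  -- The saturation of `U`: an open set of `X` must respect its equality, and `U` speaks of points
  -- paired with proofs of `P`.
  V : Pred (Carrier X) _
  V x = ∃[ z ] z ∈ U × Space._≈_ X (proj₁ z) x

-- Homomorphisms

module _ {ℓ} {Ω : Signature ℓ} where

  finite⇒stone : {A : TopAlgebra Ω} → IsFinite A → IsStone A
  finite⇒stone {A} (fin , disc) =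
    finite-discrete⇒compact (space A) disc fin ,
    discrete⇒hausdorff (space A) disc ,
    discrete⇒zero-dimensional (space A) disc

module _ {i} (j : Level) {Ω : Signature (i ⊔ j)} {I : Set i} (B : I → TopAlgebra Ω) where

  projection : ∀ k → ContinuousHom (directProduct j B) (B k)
  projection k = record
    { map = record
      { func       = record { to = λ x → x k ; cong = λ e → e k }
      ; continuous = Π-proj-continuous j (space ∘ B) k
      }
    ; hom = λ _ _ → Setoid.refl (points (space (B k)))
    }

  tuple : {A : TopAlgebra Ω} → (∀ k → ContinuousHom A (B k)) →
          ContinuousHom A (directProduct j B)
  tuple {A} φ = record
    { map = record
      { func       = record
        { to   = λ x k → apply (φ k) x
        ; cong = λ e k → ContinuousMap.cong (ContinuousHom.map (φ k)) e
        }
      ; continuous = Π-tuple-continuous j (space ∘ B) (space A) _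
                       (λ k → continuous (ContinuousHom.map (φ k)))
      }
    ; hom = λ ω x k → ContinuousHom.hom (φ k) ω x
    }

module Classical (em : ∀ {a} → ExcludedMiddle a) where

  -- Finite Hausdorff spaces, images and subspaces

  module _ {ℓ} (X : Space ℓ) (Xhaus : Hausdorff X) where
    open Space X using (_≈_; open-resp-≈; open-∩; open-⊤)
    open Setoid (points X) using (sym; trans)

    -- Intersect the Hausdorff neighbourhoods of `x` against those listed points that differ from
    -- it.
    isolate : ∀ x ys → ∃[ W ] Open X W × x ∈ W ×
              (∀ {z} → z ∈ W → Any (z ≈_) ys → z ≈ x)
    isolate x []       = (λ _ → ⊤) , open-⊤ , tt , λ _ ()
    isolate x (y ∷ ys) with em {P = x ≈ y} | isolate x ys
    ... | yes x≈y | W , oW , x∈W , W-iso = W , oW , x∈W , λ where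
      z∈W (here z≈y)  → trans z≈y (sym x≈y)
      z∈W (there any) → W-iso z∈W any
    ... | no x≉y | W , oW , x∈W , W-iso
      with U , V , oU , _ , x∈U , y∈V , U∩V=∅ ← Xhaus x y x≉y =
      U ∩ W , open-∩ oU oW , (x∈U , x∈W) , λ where
        (z∈U , _) (here z≈y)  → contradiction y∈V (U∩V=∅ (open-resp-≈ oU z≈y z∈U))
        (_ , z∈W) (there any) → W-iso z∈W any

    -- When `ys` lists the whole space, `isolate` yields a neighbourhood of `x` inside its own
    -- class.
    finite-hausdorff⇒discrete : Finite X → Discrete X
    finite-hausdorff⇒discrete fin U resp = locally-open X λ {x} x∈U →
      let (ys , ∈ys) = finite⇒enumerable (points X) fin
          (W , oW , x∈W , W-iso) = isolate x ys
      in W , oW , x∈W , λ z∈W → resp (sym (W-iso z∈W (∈ys _))) x∈U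

  surjection-finite : ∀ {ℓ} (X Y : Space ℓ) (f : Carrier X → Carrier Y) →
                      Surjective (Space._≈_ X) (Space._≈_ Y) f → Finite X → Finite Y
  surjection-finite X Y f surj fin = enumerable⇒finite (points Y) (λ _ _ → em)
    (enumerable-image (points X) (points Y) f surj (finite⇒enumerable (points X) fin))

  subspace-finite : ∀ {ℓ} (X : Space ℓ) P → Finite X → Finite (subspace X P)
  subspace-finite X P fin =
    let (xs , ∈xs) = finite⇒enumerable (points X) fin
    in enumerable⇒finite (points (subspace X P)) (λ _ _ → em)
         (select xs , λ (x , p) → ∈select p xs (∈xs x))
    where
    open Space X using (_≈_)
    -- P need not respect ≈, so a point of P is sought in the class of each x.
    select : List (Carrier X) → List (∃ P)
    select []       = []
    select (x ∷ xs) with em {P = ∃[ y ] P y × y ≈ x}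
    ... | yes (y , p , _) = (y , p) ∷ select xs
    ... | no _            = select xs
    ∈select : ∀ {x} → P x → ∀ xs → Any (x ≈_) xs → Any (λ y → x ≈ proj₁ y) (select xs)
    ∈select p (x ∷ xs) x∈ with em {P = ∃[ y ] P y × y ≈ x} | x∈
    ... | yes (_ , _ , y≈x) | here e   = here (Setoid.trans (points X) e (Setoid.sym (points X) y≈x))
    ... | yes _             | there x∈ = there (∈select p xs x∈)
    ... | no ∄y             | here e   = contradiction (_ , p , e) ∄y
    ... | no _              | there x∈ = ∈select p xs x∈

  -- Closed images of compact spaces

  module _ {ℓ} {X Y : Space ℓ} (f : ContinuousMap X Y) where
    private
      module X = Space X
      module Y = Space Y

    Image : Pred X.Carrier ℓ → Pred Y.Carrier ℓ
    Image C y = ∃[ x ] x ∈ C × to f x Y.≈ y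

    -- Separate a point `y` outside the image from each `to f x` with `x ∈ C`. The preimages of the
    -- separating sets, together with `∁ C`, cover `X`; the neighbourhoods of `y` that belong to a
    -- finite subcover intersect in one that misses the image.
    compact-image-closed : Compact X → Hausdorff Y →
                           ∀ {C} → Closed X C → Closed Y (Image C)
    compact-image-closed Xcomp Yhaus {C} (_ , o∁C) =
      (λ e (x , c , fx≈y) → x , c , Setoid.trans Y.points fx≈y e) ,
      locally-open Y complement-nbhd
      where
      module _ {y} (y∉ : y ∉ Image C) where
        separate : ((x , _) : ∃ C) → ∃[ U ] ∃[ V ] Open Y U × Open Y V × to f x ∈ U × y ∈ V ×
                                   (∀ {z} → z ∈ U → ¬ (z ∈ V))
        separate (x , c) = Yhaus (to f x) y (λ e → y∉ (x , c , e))

        -- `nothing` stands for `∁ C`: compactness is that of `X`, so the points outside `C` have to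
        -- be covered too.
        U : Maybe (∃ C) → Pred X.Carrier ℓ
        U nothing  = ∁ C
        U (just c) = to f ⊢ proj₁ (separate c)

        U-open : ∀ m → X.Open (U m)
        U-open nothing  = o∁C
        U-open (just c) = let (_ , _ , oU , _) = separate c in continuous f oU

        U-covers : ∀ x → ∃[ m ] x ∈ U m
        U-covers x with em {P = x ∈ C}
        ... | yes c = just (x , c) , let (_ , _ , _ , _ , fx∈U , _) = separate (x , c) in fx∈U
        ... | no ¬c = nothing , ¬c

        avoid : ∀ ms → ∃[ W ] Y.Open W × y ∈ W ×
                (∀ {x} → to f x ∈ W → Any (λ m → x ∈ U m) ms → x ∉ C)
        avoid []             = (λ _ → ⊤) , Y.open-⊤ , tt , λ _ ()
        avoid (nothing ∷ ms) =
          let (W , oW , y∈W , W-avoids) = avoid ms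
          in W , oW , y∈W , λ where
            _ (here ¬c)   → ¬c
            w (there any) → W-avoids w any
        avoid (just c ∷ ms)  =
          let (W , oW , y∈W , W-avoids) = avoid ms
              (_ , V , _ , oV , _ , y∈V , U∩V=∅) = separate c
          in V ∩ W , Y.open-∩ oV oW , (y∈V , y∈W) , λ where
            (v , _) (here u)    → contradiction v (U∩V=∅ u)
            (_ , w) (there any) → W-avoids w any

        complement-nbhd : ∃[ W ] Y.Open W × y ∈ W × W ⊆ ∁ (Image C)
        complement-nbhd =
          let (ms , ∈ms) = Xcomp U U-open U-covers
              (W , oW , y∈W , W-avoids) = avoid ms
          in W , oW , y∈W , λ z∈W (x , c , fx≈z) →
             W-avoids (Y.open-resp-≈ oW (Setoid.sym Y.points fx≈z) z∈W) (∈ms x) c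

  -- The range of a homomorphism and its inverse

  module _ {ℓ} {Ω : Signature ℓ} {A B : TopAlgebra Ω} (φ : ContinuousHom A B)
           (Acomp : Compact (space A)) (Bhaus : Hausdorff (space B)) where
    private
      module A = TopAlgebra A
      module B = TopAlgebra B
      module ≈B = Setoid (points B.space)
      f = ContinuousHom.map φ

    range : Pred B.Carrier ℓ
    range = Image f (λ _ → ⊤)

    range-closed-subalgebra : IsClosedSubalgebra B range
    range-closed-subalgebra = record
      { closed    = compact-image-closed f Acomp Bhaus
          ((λ _ _ → tt) , locally-open A.space (λ ∉⊤ → ⊥-elim (∉⊤ tt)))
      ; op-closed = λ {n} ω y y∈ → A.op ω (proj₁ ∘ y∈) , tt ,
          ≈B.trans (ContinuousHom.hom φ ω (proj₁ ∘ y∈))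
            (ContinuousMap.cong (B.eval n)
              (Setoid.refl (points (Ω n)) , λ m → proj₂ (proj₂ (y∈ m))))
      }

    rangeAlgebra : TopAlgebra Ω
    rangeAlgebra = subalgebra B range range-closed-subalgebra

    corestriction : ContinuousHom A rangeAlgebra
    corestriction = record
      { map = record
        { func       = record
          { to   = λ x → apply φ x , x , tt , ≈B.refl
          ; cong = ContinuousMap.cong f
          }
        ; continuous = λ (V , oV , U⊆V , V⊆U) →
            Space.open-resp-≐ A.space (V⊆U , U⊆V) (continuous f oV)
        }
      ; hom = ContinuousHom.hom φ
      }

    corestriction-onto : Onto corestriction
    corestriction-onto (y , x , _ , φx≈y) =
      x , λ e → ≈B.trans (ContinuousMap.cong f e) φx≈y

    module _ (φ-inj : ∀ {x y} → apply φ x B.≈ apply φ y → x A.≈ y) where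

      -- An element of the range carries a preimage, so the inverse is a projection, and injectivity
      -- makes it respect equality. The preimage of an open `U` is the complement of the image of
      -- `∁ U`, which is closed.
      inverse : ContinuousHom rangeAlgebra A
      inverse = record
        { map = record
          { func       = record
            { to   = λ (_ , x , _) → x
            ; cong = λ { {_ , _ , _ , e} {_ , _ , _ , e′} y≈y′ →
                φ-inj (≈B.trans e (≈B.trans y≈y′ (≈B.sym e′))) }
            }
          ; continuous = λ {U} oU →
              let resp = Space.open-resp-≈ A.space oU
                  ∁U-closed : Closed A.space (∁ U)
                  ∁U-closed =
                    (λ e ∉U → ∉U ∘ resp (Setoid.sym (points A.space) e)) ,
                    Space.open-resp-≐ A.space
                      ((λ u ∉U → ∉U u) , decidable-stable em) oU
              in ∁ (Image f (∁ U)) , proj₂ (compact-image-closed f Acomp Bhaus ∁U-closed) ,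
                 (λ { {_ , x , _ , e} x∈U (x′ , x′∉U , e′) →
                     x′∉U (resp (φ-inj (≈B.trans e (≈B.sym e′))) x∈U) }) ,
                 (λ { {_ , x , _ , e} y∉ → decidable-stable em (λ x∉U → y∉ (x , x∉U , e)) })
          }
        -- In the range, the preimage stored with a value of an operation is that operation applied
        -- to the stored preimages.
        ; hom = λ _ _ → Setoid.refl (points A.space)
        }

      inverse-onto : Onto inverse
      inverse-onto x = (apply φ x , x , tt , ≈B.refl) ,
        λ { {_ , _ , _ , e} y≈φx → φ-inj (≈B.trans e y≈φx) }

  -- Finite members of varieties and pseudovarieties

  module _ {ℓ} {Ω : Signature ℓ} where

    subalgebra-finite : {A : TopAlgebra Ω} → IsFinite A → ∀ P (sub : IsClosedSubalgebra A P) →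
                        IsFinite (subalgebra A P sub)
    subalgebra-finite {A} (fin , disc) P _ =
      subspace-finite (space A) P fin , subspace-discrete (space A) P disc

    product-finite : ∀ n (A : Fin n → TopAlgebra Ω) → (∀ k → IsFinite (A k)) →
                     IsFinite (directProduct ℓ A)
    product-finite n A fin =
      enumerable⇒finite (Π-setoid ℓ (space ∘ A)) (λ _ _ → em)
        (Π-enumerable n (space ∘ A) (λ k → finite⇒enumerable (points (space (A k))) (proj₁ (fin k)))) ,
      Π-discrete n (space ∘ A) (proj₂ ∘ fin)

    module _ {s} {S : Pred (TopAlgebra Ω) s} (S-stone : S ⊆ IsStone)
             (images : ClosedUnderStoneImages S) (subalgebras : ClosedUnderClosedSubalgebras S) where

      -- The range of `φ` is a closed subalgebra of `B`, and `inverse` maps it onto `A`.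
      closed-under-embeddings : ∀ {A B} → IsStone A → B ∈ S → (φ : ContinuousHom A B) →
        (∀ {x y} → TopAlgebra._≈_ B (apply φ x) (apply φ y) → TopAlgebra._≈_ A x y) → A ∈ S
      closed-under-embeddings A-stone@(Acomp , _) B∈S φ φ-inj =
        let Bhaus = proj₁ (proj₂ (S-stone B∈S))
        in images (subalgebras B∈S _ (range-closed-subalgebra φ Acomp Bhaus)) A-stone
             (inverse φ Acomp Bhaus φ-inj) (inverse-onto φ Acomp Bhaus φ-inj)

    -- The empty product serves for the pairs of equal points.
    residually⇒separating : ∀ {s} {S : Pred (TopAlgebra Ω) s} → IsStonePseudovariety S →
      ∀ {A} → Residually S A → ∀ x y →
      Σ[ B ∈ TopAlgebra Ω ] B ∈ S × Σ[ φ ∈ ContinuousHom A B ]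
        (TopAlgebra._≈_ B (apply φ x) (apply φ y) → TopAlgebra._≈_ A x y)
    residually⇒separating psv {A} res x y with em {P = TopAlgebra._≈_ A x y}
    ... | yes x≈y = _ , IsStonePseudovariety.finiteProducts psv 0 (λ ()) (λ ()) ,
                    tuple ℓ (λ ()) {A} (λ ()) , λ _ → x≈y
    ... | no x≉y  = let (B , B∈S , φ , φx≉φy) = res x y x≉y
                    in B , B∈S , φ , λ e → contradiction e φx≉φy

    variety-finite-part-pseudovariety : ∀ {v} {V : Pred (TopAlgebra Ω) v} →
      IsStoneVariety V → IsStonePseudovariety (V ∩ IsFinite)
    variety-finite-part-pseudovariety {V = V} var = record
      { stone          = V-stone ∘ proj₁
      -- A given member of `V` may be infinite, but the empty product is a one-point algebra.
      ; nonempty       = _ , finite-product 0 (λ ()) (λ ())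
      ; images         = λ {A} {B} (A∈V , A-fin , _) B-stone φ onto →
          let B-fin = surjection-finite (space A) (space B) (apply φ) onto A-fin
          in images A∈V B-stone φ onto , B-fin ,
             -- `IsFinite` also asks for discreteness, which `B` owes to being Hausdorff.
             finite-hausdorff⇒discrete (space B) (proj₁ (proj₂ B-stone)) B-fin
      ; subalgebras    = λ {A} (A∈V , A-fin) P sub →
          subalgebras A∈V P sub , subalgebra-finite {A} A-fin P sub
      ; finiteProducts = finite-product
      }
      where
      open IsStoneVariety var renaming (stone to V-stone)
      finite-product : ∀ n (A : Fin n → TopAlgebra Ω) → (∀ k → A k ∈ V ∩ IsFinite) →
                       directProduct ℓ A ∈ V ∩ IsFinite
      finite-product n A A∈ =
        -- Products in `V` are indexed by types in `Set ℓ`, so `Fin n` is lifted; reindexing maps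
        -- the lifted product onto the one over `Fin n`.
        images (products (Lift ℓ (Fin n)) (A ∘ lower) (proj₁ ∘ A∈ ∘ lower))
          (finite⇒stone {A = directProduct ℓ A} fin)
          (tuple ℓ A (λ k → projection ℓ (A ∘ lower) (lift k)))
          (λ y → y ∘ lower , λ e k → e (lift k)) ,
        fin
        where
        fin : IsFinite (directProduct ℓ A)
        fin = product-finite n A (proj₂ ∘ A∈)

    hat-finite-part⊆variety : ∀ {v} {V : Pred (TopAlgebra Ω) v} →
      IsStoneVariety V → Hat (V ∩ IsFinite) ⊆ V
    hat-finite-part⊆variety var {A} (A-stone , res) =
      closed-under-embeddings stone images subalgebras A-stone
        (products _ B (λ p → proj₁ (proj₁ (proj₂ (sep p)))))
        (tuple ℓ B (λ p → proj₁ (proj₂ (proj₂ (sep p)))))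
        -- The coordinate at the pair `(x , y)` is the one that tells `x` from `y`.
        (λ {x} {y} e → proj₂ (proj₂ (proj₂ (sep (x , y)))) (e (x , y)))
      where
      open IsStoneVariety var
      sep = uncurry (residually⇒separating (variety-finite-part-pseudovariety var) {A} res)
      B : TopAlgebra.Carrier A × TopAlgebra.Carrier A → TopAlgebra Ω
      B = proj₁ ∘ sep

    -- The finite algebra `B` that separates two points need not lie in `V`; the range of `φ` does,
    -- being a Stone image of `A`.
    profinite-variety⊆hat-finite-part : ∀ {v} {V : Pred (TopAlgebra Ω) v} →
      IsStoneVariety V → V ⊆ IsProfinite → V ⊆ Hat (V ∩ IsFinite)
    profinite-variety⊆hat-finite-part var V-profinite {A} A∈V =
      stone A∈V , λ x y x≉y →
        let (Acomp , res) = V-profinite A∈V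
            (B , B-fin@(_ , B-disc) , φ , φx≉φy) = res x y x≉y
            Bhaus = discrete⇒hausdorff (space B) B-disc
            R     = rangeAlgebra φ Acomp Bhaus
            R-fin = subalgebra-finite {B} B-fin _ (range-closed-subalgebra φ Acomp Bhaus)
        in R ,
           (images A∈V (finite⇒stone {A = R} R-fin)
              (corestriction φ Acomp Bhaus) (corestriction-onto φ Acomp Bhaus) , R-fin) ,
           corestriction φ Acomp Bhaus , φx≉φy
      where open IsStoneVariety var

    finite-residually⇒∈ : ∀ {s} {S : Pred (TopAlgebra Ω) s} → IsStonePseudovariety S →
                          ∀ {A} → IsFinite A → Residually S A → A ∈ S
    finite-residually⇒∈ psv {A} A-fin@((n , inv) , _) res =
      closed-under-embeddings stone images subalgebras (finite⇒stone {A = A} A-fin)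
        -- An index below `n * n` encodes a pair of codes of points of `A`.
        (finiteProducts (n * n) B (λ k → proj₁ (proj₂ (sep (remQuot n k)))))
        (tuple ℓ B (λ k → proj₁ (proj₂ (proj₂ (sep (remQuot n k))))))
        (λ {x} {y} e → separates (remQuot-combine (code x) (code y)) (e (combine (code x) (code y))))
      where
      open IsStonePseudovariety psv
      open Inverse inv using (from; strictlyInverseʳ) renaming (to to code)
      module ≈A = Setoid (points (space A))
      sep : ((i , j) : Fin n × Fin n) → _
      sep (i , j) = residually⇒separating psv {A} res (from i) (from j)
      B : Fin (n * n) → TopAlgebra Ω
      B = proj₁ ∘ sep ∘ remQuot n
      -- Keeping `p` general lets the match on `≡.refl` replace a transport of algebras and
      -- homomorphisms along `remQuot-combine`.
      separates : ∀ {x y p} → p ≡ (code x , code y) →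
                  let (B , _ , φ , _) = sep p in
                  TopAlgebra._≈_ B (apply φ x) (apply φ y) → x ≈A.≈ y
      separates {x} {y} ≡.refl e =
        let (B , _ , φ , inj) = sep (code x , code y)
            module ≈B = Setoid (points (space B))
            φ-cong = ContinuousMap.cong (ContinuousHom.map φ)
            x≈ = strictlyInverseʳ x
            y≈ = strictlyInverseʳ y
        -- `φ` separates the decoded points `from (code x)` and `from (code y)`, which are only
        -- equal in `A` to `x` and `y`.
        in ≈A.trans (≈A.sym x≈)
             (≈A.trans (inj (≈B.trans (φ-cong x≈) (≈B.trans e (φ-cong (≈A.sym y≈))))) y≈)

theorem5p17 : ∀ {ℓ v s} → (∀ {a} → ExcludedMiddle a) →
    (Ω : Signature ℓ) (V : Pred (TopAlgebra Ω) v) →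
    IsStoneVariety V → V ⊆ IsProfinite →
    (IsStonePseudovariety (V ∩ IsFinite) × Hat (V ∩ IsFinite) ≐ V) ×
    ((S : Pred (TopAlgebra Ω) s) → IsStonePseudovariety S → Hat S ≐ V → (V ∩ IsFinite) ⊆ S)
theorem5p17 em Ω V var V-profinite =
  ( variety-finite-part-pseudovariety var
  , hat-finite-part⊆variety var
  , profinite-variety⊆hat-finite-part var V-profinite ) ,
  -- Minimality: a finite `A` in `V` is residually `S`, and its finiteness puts it in `S` itself.
  λ S psv (_ , V⊆HatS) {A} (A∈V , A-fin) →
    finite-residually⇒∈ psv {A} A-fin (proj₂ (V⊆HatS A∈V))
  where open Classical em
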